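{- Let $F$ be an intersecting $4$-partite $4$-uniform hypergraph with parts $V_1,V_2,V_3,V_4$. If $F$ contains four edges whose bases form a matching in $V_1\times V_2$ (that is, four edges $f_1,f_2,f_3,f_4$ such that the sets $f_t\cap(V_1\cup V_2)$, $t=1,2,3,4$, are pairwise disjoint), then $\tau(F)\le 2$.
   Context: A $4$-partite $4$-uniform hypergraph $F$ has a vertex set partitioned into four pairwise disjoint parts $V_1,V_2,V_3,V_4$, and each edge is a set of four vertices containing exactly one vertex of each part. $F$ is intersecting if any two of its edges have a common vertex. The base of an edge $h$ is $h\cap(V_1\cup V_2)$, a pair consisting of one vertex of $V_1$ and one vertex of $V_2$. $\tau(F)$ is the minimum size of a vertex cover of $F$, i.e. of a set of vertices that meets every edge of $F$. -}

module Defs where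

open import Data.Bool.Base using (true; false)
open import Data.Fin.Base using (Fin)
open import Data.Fin.Patterns using (0F; 1F)
open import Data.Fin.Subset
  using (Subset; inside; outside; _∈_; _∩_; _∪_; ∣_∣; Nonempty; Empty; ⊤)
open import Data.Fin.Subset.Properties using (nonempty?; ∈⊤; x∈p∩q⁺; x∈p∩q⁻)
open import Data.List.Base using (List; []; _∷_; filter; cartesianProductWith)
open import Data.List.Extrema.Nat using (argmin; argmin-all; f[argmin]≤f[xs])
import Data.List.Membership.Propositional as List
open import Data.List.Membership.Propositional.Properties
  using (∈-cartesianProductWith⁺; ∈-filter⁺)
open import Data.List.Relation.Unary.All as All using (All; all?)
open import Data.List.Relation.Unary.All.Properties using (all-filter)
open import Data.List.Relation.Unary.Any using (here; there)
open import Data.Nat.Base using (ℕ; zero; suc; _≤_)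
open import Data.Product using (∃; ∃!; _×_; _,_; proj₁)
open import Data.Vec.Base using ([]; _∷_)
open import Relation.Binary.PropositionalEquality using (_≡_; _≢_; refl)
open import Relation.Unary using (Decidable)

-- The vertex set is Fin n.  Parts are indexed from 0, so V₁, …, V₄ are
-- part 0F, …, part 3F.  The list of edges represents a finite set of edges:
-- only membership in it is ever used, so order and repetitions are irrelevant.
record Hypergraph₄ (n : ℕ) : Set where
  field
    part          : Fin 4 → Subset n
    part-disjoint : ∀ {i j} → i ≢ j → Empty (part i ∩ part j)
    part-cover    : ∀ v → ∃ λ i → v ∈ part i
    edges         : List (Subset n)

  Edge : Subset n → Set
  Edge e = e List.∈ edges

  field
    uniform     : ∀ {e} → Edge e → ∣ e ∣ ≡ 4
    transversal : ∀ {e} → Edge e → ∀ i → ∃! _≡_ λ v → v ∈ e ∩ part i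

open Hypergraph₄ public

module _ {n : ℕ} (F : Hypergraph₄ n) where

  Intersecting : Set
  Intersecting = ∀ {e f} → Edge F e → Edge F f → Nonempty (e ∩ f)

  base : Subset n → Subset n
  base h = h ∩ (part F 0F ∪ part F 1F)

  Cover : Subset n → Set
  Cover C = All (λ e → Nonempty (C ∩ e)) (edges F)

  cover? : Decidable Cover
  cover? C = all? (λ e → nonempty? (C ∩ e)) (edges F)

subsets : ∀ n → List (Subset n)
subsets zero    = [] ∷ []
subsets (suc n) = cartesianProductWith _∷_ (outside ∷ inside ∷ []) (subsets n)

∈-subsets : ∀ {n} (p : Subset n) → p List.∈ subsets n
∈-subsets []      = here refl
∈-subsets (s ∷ p) = ∈-cartesianProductWith⁺ _∷_ (∈-sides s) (∈-subsets p)
  where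
  ∈-sides : ∀ s → s List.∈ (outside ∷ inside ∷ [])
  ∈-sides false = here refl
  ∈-sides true  = there (here refl)

module _ {n : ℕ} (F : Hypergraph₄ n) where

  -- The default value ⊤ of argmin is harmless, since ⊤ is itself a cover.
  minCover : Subset n
  minCover = argmin ∣_∣ ⊤ (filter (cover? F) (subsets n))

  τ : ℕ
  τ = ∣ minCover ∣

  ⊤-cover : Cover F ⊤
  ⊤-cover = All.tabulate λ {e} e∈F →
    let v , v∈ , _ = transversal F e∈F 0F
    in  v , x∈p∩q⁺ (∈⊤ , proj₁ (x∈p∩q⁻ e (part F 0F) v∈))

  minCover-cover : Cover F minCover
  minCover-cover = argmin-all ∣_∣ ⊤-cover (all-filter (cover? F) (subsets n))

  τ-minimal : ∀ {C} → Cover F C → τ ≤ ∣ C ∣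
  τ-minimal {C} c = All.lookup (f[argmin]≤f[xs] ⊤ (filter (cover? F) (subsets n)))
    (∈-filter⁺ (cover? F) (∈-subsets C) c)

{-# OPTIONS --safe #-}
module Submission where

-- Since V₁ and V₂ separate the four given edges, any two of them agree on V₃
-- or on V₄.  The union of two equivalence relations is total only if one of
-- them is, so all four contain one vertex c of, say, V₃.  Let e and g be edges
-- avoiding c that differ on V₄.  Each given edge then meets e or g on V₁ ∪ V₂.
-- If e and g had a common vertex on V₁ ∪ V₂, they would have only three
-- vertices there, too few to meet four disjoint bases; so e and g agree on V₃.
-- Thus any two edges avoiding c agree on V₃ or on V₄, and by the same remark
-- on equivalence relations one further vertex covers all of them.

open import Defs
open import Data.Nat.Base using (ℕ; _≤_; _+_; z≤n; s≤s)
open import Data.Nat.Properties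
  using (_≤?_; ≤-refl; ≤-trans; ≤-reflexive; n≤1+n; +-suc; +-mono-≤; +-monoʳ-≤)
open import Data.Fin.Base using (Fin)
open import Data.Fin.Patterns using (0F; 1F; 2F; 3F)
open import Data.Fin.Properties using (_≟_; <⇒≢; pigeonhole; ¬∀⟶∃¬)
open import Data.Fin.Subset
  using (Subset; inside; outside; Empty; _∩_; _∪_; _∈_; ⁅_⁆; ∣_∣)
open import Data.Fin.Subset.Properties
  using (x∈p∩q⁺; x∈p∩q⁻; x∈p∪q⁺; x∈⁅x⁆; ∣⁅x⁆∣≡1; nonempty?)
open import Data.List.Membership.Propositional using (find)
open import Data.List.Relation.Unary.All.Properties using (¬All⇒Any¬)
open import Data.Product using (∃; _×_; _,_; proj₁; proj₂)
open import Data.Sum.Base using (_⊎_; inj₁; inj₂; map₂; swap)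
open import Data.Vec.Base using ([]; _∷_)
open import Function.Base using (_∘_)
open import Function.Definitions using (Injective)
open import Relation.Binary.Definitions using (DecidableEquality)
open import Relation.Binary.PropositionalEquality
  using (_≡_; _≢_; refl; sym; trans; subst; ≢-sym)
open import Relation.Nullary using (¬_; yes; no; contradiction; decidable-stable)

-- If `p` separates `x` from `y` and `q` separates `x` from `z`, then `q x ≡ q y` and `p x ≡ p z`.
-- Either agreement of `y` with `z` then undoes one of the two separations.
agree-on-one : ∀ {a b c} {A : Set a} {B : Set b} {C : Set c}
               {p : A → B} {q : A → C} {x y z : A} →
               (p x ≡ p y ⊎ q x ≡ q y) → (p x ≡ p z ⊎ q x ≡ q z) →
               (p y ≡ p z ⊎ q y ≡ q z) →
               p x ≢ p y → ¬ (q x ≢ q z)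
agree-on-one (inj₁ pxy) _ _ p≢ _ = p≢ pxy
agree-on-one _ (inj₂ qxz) _ _ q≢ = q≢ qxz
agree-on-one _ (inj₁ pxz) (inj₁ pyz) p≢ _ = p≢ (trans pxz (sym pyz))
agree-on-one (inj₂ qxy) _ (inj₂ qyz) _ q≢ = q≢ (trans qxy qyz)

-- Pigeonhole: by injectivity each of the three values accounts for at most one of the four indices.
three-miss-matching : ∀ {a} {A : Set a} {p q : Fin 4 → A} →
                      Injective _≡_ _≡_ p → Injective _≡_ _≡_ q →
                      ∀ {x y z} → ¬ (∀ t → x ≡ p t ⊎ y ≡ q t ⊎ z ≡ q t)
three-miss-matching {p = p} {q} p-inj q-inj {x} {y} {z} hit =
  let s , t , s<t , same = pigeonhole ≤-refl (proj₁ ∘ slot)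
      slot-t = subst (λ k → Slot k t) (sym same) (proj₂ (slot t))
  in  <⇒≢ s<t (slot-unique (proj₁ (slot s)) (proj₂ (slot s)) slot-t)
  where
  Slot : Fin 3 → Fin 4 → Set _
  Slot 0F t = x ≡ p t
  Slot 1F t = y ≡ q t
  Slot 2F t = z ≡ q t

  slot : ∀ t → ∃ λ k → Slot k t
  slot t with hit t
  ... | inj₁ eq        = 0F , eq
  ... | inj₂ (inj₁ eq) = 1F , eq
  ... | inj₂ (inj₂ eq) = 2F , eq

  slot-unique : ∀ k {s t} → Slot k s → Slot k t → s ≡ t
  slot-unique 0F x≡ps x≡pt = p-inj (trans (sym x≡ps) x≡pt)
  slot-unique 1F y≡qs y≡qt = q-inj (trans (sym y≡qs) y≡qt)
  slot-unique 2F z≡qs z≡qt = q-inj (trans (sym z≡qs) z≡qt)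

-- Edges enter only through their vertices in the four parts, so that the argument also serves with
-- `c` and `d` exchanged, when the common vertex lies in V₄.
module _ {e v} {E : Set e} {V : Set v} {a b c d : E → V}
  (_≟_ : DecidableEquality V)
  (meet : ∀ e g → a e ≡ a g ⊎ b e ≡ b g ⊎ c e ≡ c g ⊎ d e ≡ d g)
  (f : Fin 4 → E) (a-inj : Injective _≡_ _≡_ (a ∘ f)) (b-inj : Injective _≡_ _≡_ (b ∘ f))
  {c₀ : V} (c-const : ∀ t → c (f t) ≡ c₀)
  where

  meet-matching : ∀ {e} → c e ≢ c₀ → ∀ t → a e ≡ a (f t) ⊎ b e ≡ b (f t) ⊎ d e ≡ d (f t)
  meet-matching {e} c≢ t with meet e (f t)
  ... | inj₁ a≡               = inj₁ a≡
  ... | inj₂ (inj₁ b≡)        = inj₂ (inj₁ b≡)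
  ... | inj₂ (inj₂ (inj₁ c≡)) = contradiction (trans c≡ (c-const t)) c≢
  ... | inj₂ (inj₂ (inj₂ d≡)) = inj₂ (inj₂ d≡)

  avoiding-agree : ∀ {e g} → c e ≢ c₀ → c g ≢ c₀ → c e ≡ c g ⊎ d e ≡ d g
  avoiding-agree {e} {g} ce≢ cg≢ with meet e g | d e ≟ d g
  ... | inj₂ (inj₂ cd) | _      = cd
  ... | _              | yes d≡ = inj₂ d≡
  -- The two edges share their `a`-vertex, which leaves `a e`, `b e` and `b g` to meet four disjoint
  -- bases.
  ... | inj₁ a≡        | no d≢  = contradiction hit (three-miss-matching a-inj b-inj)
    where
    hit : ∀ t → a e ≡ a (f t) ⊎ b e ≡ b (f t) ⊎ b g ≡ b (f t)
    hit t with meet-matching ce≢ t | meet-matching cg≢ t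
    ... | inj₁ h        | _             = inj₁ h
    ... | inj₂ (inj₁ h) | _             = inj₂ (inj₁ h)
    ... | _             | inj₁ k        = inj₁ (trans a≡ k)
    ... | _             | inj₂ (inj₁ k) = inj₂ (inj₂ k)
    ... | inj₂ (inj₂ h) | inj₂ (inj₂ k) = contradiction (trans h (sym k)) d≢
  ... | inj₂ (inj₁ b≡) | no d≢  = contradiction hit (three-miss-matching b-inj a-inj)
    where
    hit : ∀ t → b e ≡ b (f t) ⊎ a e ≡ a (f t) ⊎ a g ≡ a (f t)
    hit t with meet-matching ce≢ t | meet-matching cg≢ t
    ... | inj₂ (inj₁ h) | _             = inj₁ h
    ... | inj₁ h        | _             = inj₂ (inj₁ h)
    ... | _             | inj₂ (inj₁ k) = inj₁ (trans b≡ k)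
    ... | _             | inj₁ k        = inj₂ (inj₂ k)
    ... | inj₂ (inj₂ h) | inj₂ (inj₂ k) = contradiction (trans h (sym k)) d≢

  -- Otherwise neither `c₀` with `c e` nor `c₀` with `d e` covers, and the edges missed by these
  -- pairs, together with `e`, violate `agree-on-one`. The second vertex `y` may lie in either part,
  -- hence the two conditions on it.
  ¬all-pairs-missed : ¬ (∀ x y → ∃ λ e → c e ≢ x × c e ≢ y × d e ≢ y)
  ¬all-pairs-missed miss =
    -- Any edge avoiding `c₀` will do here; the repeated `c₀` is a filler.
    let e , e≢c₀ , _           = miss c₀ c₀
        g , g≢c₀ , g≢ce , _    = miss c₀ (c e)
        h , h≢c₀ , _    , h≢de = miss c₀ (d e)
    in  agree-on-one {p = c} {q = d} {x = e} {y = g} {z = h}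
          (avoiding-agree e≢c₀ g≢c₀) (avoiding-agree e≢c₀ h≢c₀) (avoiding-agree g≢c₀ h≢c₀)
          (≢-sym g≢ce) (≢-sym h≢de)

∣p∪q∣≤∣p∣+∣q∣ : ∀ {n} (p q : Subset n) → ∣ p ∪ q ∣ ≤ ∣ p ∣ + ∣ q ∣
∣p∪q∣≤∣p∣+∣q∣ []            []            = z≤n
∣p∪q∣≤∣p∣+∣q∣ (outside ∷ p) (outside ∷ q) = ∣p∪q∣≤∣p∣+∣q∣ p q
∣p∪q∣≤∣p∣+∣q∣ (outside ∷ p) (inside  ∷ q) =
  ≤-trans (s≤s (∣p∪q∣≤∣p∣+∣q∣ p q)) (≤-reflexive (sym (+-suc ∣ p ∣ ∣ q ∣)))
∣p∪q∣≤∣p∣+∣q∣ (inside  ∷ p) (outside ∷ q) = s≤s (∣p∪q∣≤∣p∣+∣q∣ p q)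
∣p∪q∣≤∣p∣+∣q∣ (inside  ∷ p) (inside  ∷ q) =
  s≤s (≤-trans (∣p∪q∣≤∣p∣+∣q∣ p q) (+-monoʳ-≤ ∣ p ∣ (n≤1+n ∣ q ∣)))

∣⁅x⁆∪⁅y⁆∣≤2 : ∀ {n} (x y : Fin n) → ∣ ⁅ x ⁆ ∪ ⁅ y ⁆ ∣ ≤ 2
∣⁅x⁆∪⁅y⁆∣≤2 x y = ≤-trans (∣p∪q∣≤∣p∣+∣q∣ ⁅ x ⁆ ⁅ y ⁆)
  (+-mono-≤ (≤-reflexive (∣⁅x⁆∣≡1 x)) (≤-reflexive (∣⁅x⁆∣≡1 y)))

module _ {n : ℕ} (F : Hypergraph₄ n) where

  vertex : ∃ (Edge F) → Fin 4 → Fin n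
  vertex (_ , e∈F) i = proj₁ (transversal F e∈F i)

  vertex∈edge : ∀ e i → vertex e i ∈ proj₁ e
  vertex∈edge (e , e∈F) i = proj₁ (x∈p∩q⁻ e _ (proj₁ (proj₂ (transversal F e∈F i))))

  vertex∈part : ∀ e i → vertex e i ∈ part F i
  vertex∈part (e , e∈F) i = proj₂ (x∈p∩q⁻ e _ (proj₁ (proj₂ (transversal F e∈F i))))

  vertex-unique : ∀ e {i w} → w ∈ proj₁ e → w ∈ part F i → vertex e i ≡ w
  vertex-unique (e , e∈F) {i} w∈e w∈i = proj₂ (proj₂ (transversal F e∈F i)) (x∈p∩q⁺ (w∈e , w∈i))

  common-vertex : Intersecting F → ∀ e g → ∃ λ i → vertex e i ≡ vertex g i
  common-vertex int e g =
    let w , w∈e∩g = int (proj₂ e) (proj₂ g)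
        w∈e , w∈g = x∈p∩q⁻ (proj₁ e) _ w∈e∩g
        i , w∈i   = part-cover F w
    in  i , trans (vertex-unique e w∈e w∈i) (sym (vertex-unique g w∈g w∈i))

  -- A cover `⁅ x ⁆ ∪ ⁅ y ⁆` would give `τ F ≤ 2`, even when `x` and `y` coincide.
  missed-edge : ¬ (τ F ≤ 2) → ∀ x y → ∃ λ e → ∀ i → vertex e i ≢ x × vertex e i ≢ y
  missed-edge τ≰2 x y =
    let e , e∈F , missed = find (¬All⇒Any¬ (λ e → nonempty? (C ∩ e)) (edges F)
          λ cover → τ≰2 (≤-trans (τ-minimal F cover) (∣⁅x⁆∪⁅y⁆∣≤2 x y)))
        missed-by : ∀ {w} → w ∈ C → ∀ i → vertex (e , e∈F) i ≢ w
        missed-by w∈C i v≡w =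
          missed (_ , x∈p∩q⁺ (w∈C , subst (_∈ e) v≡w (vertex∈edge (e , e∈F) i)))
    in  (e , e∈F) , λ i → missed-by (x∈p∪q⁺ (inj₁ (x∈⁅x⁆ x))) i ,
                          missed-by (x∈p∪q⁺ (inj₂ (x∈⁅x⁆ y))) i
    where
    C : Subset n
    C = ⁅ x ⁆ ∪ ⁅ y ⁆

lemma2p2 : ∀ (n : ℕ) (F : Hypergraph₄ n) → Intersecting F →
    (f : Fin 4 → Subset n) → (∀ t → Edge F (f t)) →
    (∀ {s t} → s ≢ t → Empty (base F (f s) ∩ base F (f t))) →
    τ F ≤ 2
lemma2p2 n F int f f∈F disjoint = decidable-stable (τ F ≤? 2) λ τ≰2 →
  let missed = missed-edge F τ≰2
      -- The four given edges cannot all share their V₃-vertex, so one of them differs there from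
      -- the first; likewise `t` for V₄.
      s , cs≢ = ¬∀⟶∃¬ 4 _ (λ t → v 2F (h t) ≟ v 2F (h 0F)) λ c-const →
        ¬all-pairs-missed _≟_ meet h a-inj b-inj c-const λ x y →
          let e , m = missed x y in e , proj₁ (m 2F) , proj₂ (m 2F) , proj₂ (m 3F)
      t , dt≢ = ¬∀⟶∃¬ 4 _ (λ t → v 3F (h t) ≟ v 3F (h 0F)) λ d-const →
        ¬all-pairs-missed _≟_ meet′ h a-inj b-inj d-const λ x y →
          let e , m = missed x y in e , proj₁ (m 3F) , proj₂ (m 3F) , proj₂ (m 2F)
  in  agree-on-one {p = v 2F ∘ h} {q = v 3F ∘ h} {x = 0F} {y = s} {z = t}
        (agree 0F s) (agree 0F t) (agree s t) (≢-sym cs≢) (≢-sym dt≢)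
  where
  h : Fin 4 → ∃ (Edge F)
  h t = f t , f∈F t

  v : Fin 4 → ∃ (Edge F) → Fin n
  v i e = vertex F e i

  -- A vertex of V₁ or V₂ shared by two given edges would lie in both bases.
  inj-on-base : ∀ i → (∀ {w} → w ∈ part F i → w ∈ part F 0F ∪ part F 1F) →
                Injective _≡_ _≡_ (v i ∘ h)
  inj-on-base i i⊆ {s} {t} eq = decidable-stable (s ≟ t) λ s≢t →
    disjoint s≢t (v i (h s) , x∈p∩q⁺
      ( x∈p∩q⁺ (vertex∈edge F (h s) i , i⊆ (vertex∈part F (h s) i))
      , x∈p∩q⁺ (subst (_∈ f t) (sym eq) (vertex∈edge F (h t) i) , i⊆ (vertex∈part F (h s) i))))

  a-inj : Injective _≡_ _≡_ (v 0F ∘ h)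
  a-inj = inj-on-base 0F (x∈p∪q⁺ ∘ inj₁)

  b-inj : Injective _≡_ _≡_ (v 1F ∘ h)
  b-inj = inj-on-base 1F (x∈p∪q⁺ ∘ inj₂)

  meet : ∀ e g → v 0F e ≡ v 0F g ⊎ v 1F e ≡ v 1F g ⊎ v 2F e ≡ v 2F g ⊎ v 3F e ≡ v 3F g
  meet e g with common-vertex F int e g
  ... | 0F , eq = inj₁ eq
  ... | 1F , eq = inj₂ (inj₁ eq)
  ... | 2F , eq = inj₂ (inj₂ (inj₁ eq))
  ... | 3F , eq = inj₂ (inj₂ (inj₂ eq))

  meet′ : ∀ e g → v 0F e ≡ v 0F g ⊎ v 1F e ≡ v 1F g ⊎ v 3F e ≡ v 3F g ⊎ v 2F e ≡ v 2F g
  meet′ e g = map₂ (map₂ swap) (meet e g)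

  agree : ∀ s t → v 2F (h s) ≡ v 2F (h t) ⊎ v 3F (h s) ≡ v 3F (h t)
  agree s t with meet (h s) (h t)
  ... | inj₂ (inj₂ cd) = cd
  -- Agreement on V₁ or V₂ forces `s` and `t` to be the same index.
  ... | inj₁ a≡        with refl ← a-inj a≡ = inj₁ refl
  ... | inj₂ (inj₁ b≡) with refl ← b-inj b≡ = inj₁ refl
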